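{- Let $n$ and $d$ be positive integers such that $n\ge 2d$. (i) If $n\equiv 0\pmod{40}$ and $d\equiv 4\pmod{40}$, then $\gamma^{ID}(C_n(1,d))=\frac{7n}{20}$. (ii) If $n\equiv 0\pmod{20}$ and $d\equiv 6\pmod{20}$, then $\gamma^{ID}(C_n(1,d))=\frac{7n}{20}$. (iii) If $n\equiv 0\pmod{20}$ and $d\equiv 5\pmod{20}$, then $\gamma^{LD}(C_n(1,d))=\frac{3n}{10}$.
   Context: All graphs are simple and undirected. For a graph $G=(V,E)$ and $u\in V$, $N[u]=\{u\}\cup\{v: uv\in E\}$. A code is a nonempty $C\subseteq V$, and $I(C;u)=N[u]\cap C$. $C$ is dominating if $I(C;u)\neq\emptyset$ for all $u$; identifying if dominating and $I(C;u)\neq I(C;v)$ for all distinct $u,v\in V$; locating-dominating if dominating and $I(C;u)\neq I(C;v)$ for all distinct $u,v\in V\setminus C$. $\gamma^{ID}(G)$ and $\gamma^{LD}(G)$ denote the minimum cardinality of an identifying, respectively locating-dominating, code in a finite graph $G$. For positive integers $n$ and $d_1,\dots,d_k\le n/2$, the circulant graph $C_n(d_1,\dots,d_k)$ has vertex set $\mathbb{Z}_n$, and the open neighbourhood of $u$ is $\{u\pm d_1,\dots,u\pm d_k\}$ modulo $n$. -}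

module Defs where

open import Data.Nat using (ℕ; _+_; _%_; NonZero)
open import Data.Fin using (Fin; toℕ)
open import Data.Fin.Subset using (Subset; _∈_; Nonempty)
open import Data.Product using (∃; _×_)
open import Data.Sum using (_⊎_)
open import Relation.Binary.PropositionalEquality using (_≡_; _≢_)
open import Relation.Nullary using (¬_)
open import Function.Bundles using (_⇔_)

-- A finite graph on vertex set Fin n, given by its closed-neighbourhood relation:
-- ClosedNbhd n = Fin n → Fin n → Set, where  N v u  means  v ∈ N[u].
ClosedNbhd : ℕ → Set₁
ClosedNbhd n = Fin n → Fin n → Set

StepBy : (n : ℕ) → {{NonZero n}} → ℕ → Fin n → Fin n → Set
StepBy n k u v = toℕ v ≡ (toℕ u + k) % n ⊎ toℕ u ≡ (toℕ v + k) % n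

CircAdj : (n d : ℕ) → {{NonZero n}} → Fin n → Fin n → Set
CircAdj n d u v = u ≢ v × (StepBy n 1 u v ⊎ StepBy n d u v)

CircN : (n d : ℕ) → {{NonZero n}} → ClosedNbhd n
CircN n d v u = v ≡ u ⊎ CircAdj n d u v

-- I(C;u) = N[u] ∩ C ; two such sets are equal iff they have the same members
SameI : {n : ℕ} → ClosedNbhd n → Subset n → Fin n → Fin n → Set
SameI N C u v = ∀ w → w ∈ C → (N w u ⇔ N w v)

Dominating : {n : ℕ} → ClosedNbhd n → Subset n → Set
Dominating N C = ∀ u → ∃ λ w → w ∈ C × N w u

Identifying : {n : ℕ} → ClosedNbhd n → Subset n → Set
Identifying N C = Nonempty C × Dominating N C × (∀ u v → u ≢ v → ¬ SameI N C u v)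

LocatingDominating : {n : ℕ} → ClosedNbhd n → Subset n → Set
LocatingDominating N C = Nonempty C × Dominating N C ×
  (∀ u v → ¬ (u ∈ C) → ¬ (v ∈ C) → u ≢ v → ¬ SameI N C u v)

{-# OPTIONS --safe #-}
module Submission where

-- The lower bounds are proved by discharging. Read at the positions k + i + j d, the code C becomes a
-- code on a patch of the square grid. For identifying codes, give the vertex v the charge
--   14 (|I(v)| - 2 + [|I(v)| = 1]) + 14 ([v ∈ C] - #{u : I(u) = {v}}) - 4 [v ∈ C].
-- The total is 80 |C| - 28 n, because the two terms with singletons I count the same pairs. A codeword
-- with exactly one codeword next to it can be refunded by that codeword, and a codeword next to a
-- noncodeword with |I| ≥ 3 by that vertex. Every other codeword in debt is "poor": its surroundings
-- up to distance 2 are forced, and near each of its four diagonals there is an edge between two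
-- codewords, whose component can spare 1, with exceptions that call for a detour.
-- For locating-dominating codes the charge is
--   6 (|I(v)| - 2 + [|I(v)| = 1]) + 6 (2 [v ∈ C] - #{u : I(u) = {v}}) - 2 [v ∈ C],
-- with total 40 |C| - 12 n. An exhaustive search shows that no vertex ends up in debt.
-- The upper bounds come from periodic codes, lifted along the covering of C_p(1,e) by C_n(1,d).

open import Defs
open import Data.Bool using (Bool; true; false; if_then_else_; not; _∧_; _∨_; _xor_; T)
open import Data.Bool.ListAction using (any; all)
open import Data.Bool.Properties using (T?; T-≡; T-∧; T-∨)
open import Data.Empty using (⊥; ⊥-elim)
open import Data.Fin using (Fin; toℕ)
import Data.Fin as Fin
open import Data.Fin.Patterns using (0F; 1F; 2F; 3F; 4F)
open import Data.Fin.Properties using (toℕ<n; toℕ-fromℕ<; toℕ-injective; all?; any?) renaming (_≟_ to _≟ᶠ_)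
open import Data.Fin.Subset using (Subset; ∣_∣) renaming (_∈_ to _∈ˢ_)
open import Data.List using (List; []; _∷_; [_]; _++_; map; concatMap; filter; length; tabulate)
open import Data.List.Membership.Propositional using (_∈_; find; lose)
open import Data.List.Membership.Propositional.Properties using (∈-filter⁺; ∈-tabulate⁺; ∈-tabulate⁻)
open import Data.List.Relation.Unary.All using (All; []; _∷_)
import Data.List.Relation.Unary.All as All
import Data.List.Relation.Unary.All.Properties as All
open import Data.List.Relation.Unary.Any using (Any; here; there)
import Data.List.Relation.Unary.Any as Any
import Data.List.Relation.Unary.Any.Properties as Any
open import Data.Maybe using (Maybe; just; nothing; maybe′)
import Data.Maybe as Maybe
open import Data.Nat
open import Data.Nat.DivMod
open import Data.Nat.Divisibility using (_∣_; divides; n∣m⇒m%n≡0; m%n≡0⇒n∣m)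
open import Data.Nat.Properties
open import Data.Nat.Tactic.RingSolver using (solve-∀)
open import Data.Product using (∃; _×_; _,_; proj₁; proj₂; map₁)
open import Data.Sum using (_⊎_; inj₁; inj₂)
open import Data.Unit using (⊤; tt)
import Data.Vec as Vec
open import Data.Vec.Properties using ([]=⇒lookup; lookup⇒[]=; lookup∘tabulate)
open import Function using (_∘_; id; _⇔_; mk⇔; Equivalence)
open import Relation.Binary.PropositionalEquality using (_≡_; _≢_; refl; sym; trans; cong; cong₂; subst; subst₂; module ≡-Reasoning)
open import Relation.Nullary using (¬_; ¬?; Dec; yes; no; _×-dec_; _⊎-dec_; _→-dec_)
open import Relation.Nullary.Decidable using (from-yes)

-- Polynomials in the indicators of codewords on a grid quadrant

Cell : Set
Cell = ℕ × ℕ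

infixl 6 _⊕_ _⊖_
_⊕_ _⊖_ : Cell → Cell → Cell
(i , j) ⊕ (k , l) = i + k , j + l
(i , j) ⊖ (k , l) = i ∸ k , j ∸ l

infix 4 _==_
_==_ : Cell → Cell → Bool
(i , j) == (k , l) = (i ≡ᵇ k) ∧ (j ≡ᵇ l)

==⇒≡ : ∀ x y → T (x == y) → x ≡ y
==⇒≡ (i , j) (k , l) p with Equivalence.to T-∧ p
... | p₁ , p₂ = cong₂ _,_ (≡ᵇ⇒≡ i k p₁) (≡ᵇ⇒≡ j l p₂)

-- A literal carries the value wanted at its cell. Clauses carry no signs, since every requirement
-- on a code asks for a codeword somewhere.
Literal Monomial Polynomial Clause Config : Set
Literal = Cell × Bool
Monomial = List Literal
Polynomial = List (ℕ × Monomial)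
Clause = List Cell
Config = Cell → Bool

value : Config → Monomial → ℕ
value c [] = 1
value c ((x , b) ∷ m) = if c x xor b then 0 else value c m

total : Config → Polynomial → ℕ
total c [] = 0
total c ((a , m) ∷ p) = a * value c m + total c p

Satisfies : Config → Clause → Set
Satisfies c = Any (λ x → T (c x))

Valid : List Clause → Config → Set
Valid ss c = ∀ z → All (Satisfies (c ∘ (z ⊕_))) ss

-- `nothing` is the zero monomial, `just []` the constant 1. The scan goes on after a match, as a
-- cell may occur twice in a monomial.
restrictᵐ : Cell → Bool → Monomial → Maybe Monomial
restrictᵐ w b [] = just []
restrictᵐ w b ((x , b′) ∷ m) =
  if x == w then (if b xor b′ then nothing else restrictᵐ w b m)
            else Maybe.map ((x , b′) ∷_) (restrictᵐ w b m)

addTerm : ℕ → Maybe Monomial → Polynomial → Polynomial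
addTerm a nothing p = p
addTerm a (just m) p = (a , m) ∷ p

restrict : Cell → Bool → Polynomial → Polynomial
restrict w b [] = []
restrict w b ((a , m) ∷ p) = addTerm a (restrictᵐ w b m) (restrict w b p)

restrictᵐ-value : ∀ c w b → c w ≡ b → ∀ m →
  maybe′ (value c) 0 (restrictᵐ w b m) ≡ value c m
restrictᵐ-value c w b eq [] = refl
restrictᵐ-value c w b eq ((x , b′) ∷ m) with x == w in x==w
... | true rewrite ==⇒≡ x w (subst T (sym x==w) tt) | eq with b xor b′
...   | true = refl
...   | false = restrictᵐ-value c w b eq m
restrictᵐ-value c w b eq ((x , b′) ∷ m)
    | false with restrictᵐ w b m | restrictᵐ-value c w b eq m
... | nothing | ih rewrite sym ih with c x xor b′
...   | true = refl
...   | false = refl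
restrictᵐ-value c w b eq ((x , b′) ∷ m)
    | false | just m′ | ih rewrite sym ih = refl

addTerm-total : ∀ c a m p → total c (addTerm a m p) ≡ a * maybe′ (value c) 0 m + total c p
addTerm-total c a nothing p rewrite *-zeroʳ a = refl
addTerm-total c a (just m) p = refl

restrict-total : ∀ c w b → c w ≡ b → ∀ p → total c (restrict w b p) ≡ total c p
restrict-total c w b eq [] = refl
restrict-total c w b eq ((a , m) ∷ p) = trans (addTerm-total c a (restrictᵐ w b m) (restrict w b p))
  (cong₂ (λ u v → a * u + v) (restrictᵐ-value c w b eq m) (restrict-total c w b eq p))

-- Crude bounds that let a branch of the search stop: monomials have value 0 or 1 and coefficients
-- are natural numbers, so non-constant terms count fully in `upper` and not at all in `lower`.
upper lower : Polynomial → ℕ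
upper [] = 0
upper ((a , _) ∷ p) = a + upper p
lower [] = 0
lower ((a , []) ∷ p) = a + lower p
lower ((_ , _ ∷ _) ∷ p) = lower p

value≤1 : ∀ c m → value c m ≤ 1
value≤1 c [] = ≤-refl
value≤1 c ((x , b) ∷ m) with c x xor b
... | true = z≤n
... | false = value≤1 c m

total≤upper : ∀ c p → total c p ≤ upper p
total≤upper c [] = z≤n
total≤upper c ((a , m) ∷ p) =
  +-mono-≤ (≤-trans (*-monoʳ-≤ a (value≤1 c m)) (≤-reflexive (*-identityʳ a))) (total≤upper c p)

lower≤total : ∀ c p → lower p ≤ total c p
lower≤total c [] = z≤n
lower≤total c ((a , []) ∷ p) = +-mono-≤ (≤-reflexive (sym (*-identityʳ a))) (lower≤total c p)
lower≤total c ((a , _ ∷ _) ∷ p) = ≤-trans (lower≤total c p) (m≤n+m _ _)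

-- Exhaustive search for a polynomial inequality

member : Cell → List Cell → Bool
member x = any (x ==_)

-- Truncated subtraction near the border of the quadrant may yield translates that miss w; they are
-- clauses all the same.
clausesAt : List Clause → Cell → List (Cell × Clause)
clausesAt ss w = concatMap (λ s → map (λ x → w ⊖ x , s) s) ss

-- Setting `w` to false can newly break only clauses through `w`, so only translates aimed at `w`
-- are tried.
violated : List Clause → List Cell → Cell → Bool
violated ss F w = any (λ zs → all (λ x → member (proj₁ zs ⊕ x) F) (proj₂ zs)) (clausesAt ss w)

shorter : Monomial → Monomial → Monomial
shorter [] m = m
shorter m@(_ ∷ _) [] = m
shorter m@(_ ∷ _) m′@(_ ∷ _) = if length m ≤ᵇ length m′ then m else m′

-- Branching inside a shortest non-constant monomial settles it after few decisions. A final `[]`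
-- means that both polynomials are constant.
pivot : Polynomial → Monomial → Monomial
pivot [] m = m
pivot ((_ , m′) ∷ p) m = pivot p (shorter m m′)

-- F lists the cells set to false so far; cells set to true are only recorded in p and q.
mutual
  search : ℕ → List Clause → List Cell → Polynomial → Polynomial → Bool
  search zero ss F p q = false
  search (suc n) ss F p q = (upper p ≤ᵇ lower q) ∨ branch n ss F p q (pivot p (pivot q []))

  branch : ℕ → List Clause → List Cell → Polynomial → Polynomial → Monomial → Bool
  branch n ss F p q [] = false
  branch n ss F p q ((w , _) ∷ _) =
    search n ss F (restrict w true p) (restrict w true q) ∧
    (violated ss (w ∷ F) w ∨ search n ss (w ∷ F) (restrict w false p) (restrict w false q))

AllFalse : Config → List Cell → Set
AllFalse c = All (λ x → c x ≡ false)

member-false : ∀ c F → AllFalse c F → ∀ x → T (member x F) → ¬ T (c x)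
member-false c F af x m cx with find (Any.any⁻ (x ==_) F m)
... | y , y∈F , eq rewrite ==⇒≡ x y eq = subst T (All.lookup af y∈F) cx

clausesAt-sound : ∀ ss w {z s} → (z , s) ∈ clausesAt ss w → s ∈ ss
clausesAt-sound ss w zs∈ with find (Any.concatMap⁻ (λ s → map (λ x → w ⊖ x , s) s) {xs = ss} zs∈)
... | s′ , s′∈ , zs∈′ with find (Any.map⁻ zs∈′)
... | _ , _ , refl = s′∈

violated-sound : ∀ ss c F w → Valid ss c → AllFalse c F → ¬ T (violated ss F w)
violated-sound ss c F w valid af v
  with find (Any.any⁻ (λ zs → all (λ x → member (proj₁ zs ⊕ x) F) (proj₂ zs)) (clausesAt ss w) v)
... | (z , s) , zs∈ , a with find (All.lookup (valid z) (clausesAt-sound ss w zs∈))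
... | x , x∈ , cx = member-false c F af (z ⊕ x) (All.lookup (All.all⁺ _ s a) x∈) cx

mutual
  -- At each pivot `c` agrees with one of the two branches, where restriction leaves both totals
  -- unchanged; it never enters a branch cut off by a violated clause.
  search-sound : ∀ n ss F p q → T (search n ss F p q) →
    ∀ c → Valid ss c → AllFalse c F → total c p ≤ total c q
  search-sound (suc n) ss F p q t c valid af with Equivalence.to T-∨ t
  ... | inj₁ le = ≤-trans (total≤upper c p) (≤-trans (≤ᵇ⇒≤ _ _ le) (lower≤total c q))
  ... | inj₂ br = branch-sound n ss F p q (pivot p (pivot q [])) br c valid af

  branch-sound : ∀ n ss F p q m → T (branch n ss F p q m) →
    ∀ c → Valid ss c → AllFalse c F → total c p ≤ total c q
  branch-sound n ss F p q ((w , _) ∷ _) t c valid af with Equivalence.to T-∧ t | c w in eq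
  ... | t₁ , _ | true = subst₂ _≤_ (restrict-total c w true eq p) (restrict-total c w true eq q)
    (search-sound n ss F _ _ t₁ c valid af)
  ... | _ , t₂ | false with Equivalence.to T-∨ t₂
  ...   | inj₁ v = ⊥-elim (violated-sound ss c (w ∷ F) w valid (eq ∷ af) v)
  ...   | inj₂ t₃ = subst₂ _≤_ (restrict-total c w false eq p) (restrict-total c w false eq q)
    (search-sound n ss (w ∷ F) _ _ t₃ c valid (eq ∷ af))

-- Properties of codes as clauses on the grid

shift : Cell → Monomial → Monomial
shift z = map (map₁ (z ⊕_))

-- The directions are numbered as in `step`. On the border of the quadrant `pred` truncates, hence
-- the later condition `Interior`.
neighbour : Cell → Fin 5 → Cell
neighbour (i , j) 0F = i , j
neighbour (i , j) 1F = suc i , j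
neighbour (i , j) 2F = pred i , j
neighbour (i , j) 3F = i , suc j
neighbour (i , j) 4F = i , pred j

closed neighbours : Cell → List Cell
closed x = tabulate (neighbour x)
neighbours x = tabulate (neighbour x ∘ Fin.suc)

infixl 5 _∖_
_∖_ : List Cell → List Cell → List Cell
xs ∖ ys = filter (λ x → ¬? (T? (member x ys))) xs

-- The symmetric difference of the closed neighbourhoods: it contains a codeword exactly when I(u)
-- and I(v) differ.
separator : Cell × Cell → Clause
separator (u , v) = (closed u ∖ closed v) ++ (closed v ∖ closed u)

-- Vertices at distance 3 or more have disjoint closed neighbourhoods, so domination separates them.
closePairs : List (Cell × Cell)
closePairs = ((1 , 1) , (2 , 1)) ∷ ((1 , 1) , (1 , 2)) ∷ ((1 , 1) , (3 , 1)) ∷ ((1 , 1) , (1 , 3)) ∷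
             ((1 , 1) , (2 , 2)) ∷ ((2 , 1) , (1 , 2)) ∷ []

identifyingClauses locatingClauses : List Clause
identifyingClauses = closed (1 , 1) ∷ map separator closePairs
locatingClauses = closed (1 , 1) ∷ map (λ uv → proj₁ uv ∷ proj₂ uv ∷ separator uv) closePairs

-- Discharging rules

-- A rule applies at every translate, so its condition occurs as often seen from the giver as seen
-- from the receiver.
record Transfer : Set where
  constructor transfer
  field
    amount : ℕ
    giver receiver : Cell
    condition : Monomial

-- Rules live in the box [0 , 16]², so that 16 , 16 ⊖ x moves any cell x of a rule to (16 , 16)
-- without truncation; the local inequality is written at that cell.
gain loss : Transfer → ℕ × Monomial
gain (transfer a g r m) = a , shift ((16 , 16) ⊖ r) m
loss (transfer a g r m) = a , shift ((16 , 16) ⊖ g) m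

cells : ℕ → List Cell → Polynomial
cells a = map (λ x → a , [ x , true ])

base : ℕ → ℕ → Polynomial
base a b = cells a (neighbours (16 , 16)) ++ cells b [ 16 , 16 ]

-- Tests that the final charge at (16,16) is nonnegative. Subtracted terms stand on the left, which
-- avoids negative coefficients; 100 bounds the depth of the search.
balanced : List Clause → ℕ → ℕ → ℕ → List Transfer → Bool
balanced ss a b e ts = search 100 ss [] ((e , []) ∷ map loss ts) (base a b ++ map gain ts)

transport : (Cell → Cell) → Transfer → Transfer
transport σ (transfer a g r m) = transfer a (σ g) (σ r) (map (map₁ σ) m)

-- Both fix (8,8), the centre of the box, where `o` lies.
rotate reflect : Cell → Cell
rotate (i , j) = 16 ∸ j , i
reflect (i , j) = 16 ∸ i , j

-- A rule that is its own mirror image in the line through `o` and `east` takes `rotations`, the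
-- others `symmetries`, so that no instance is listed twice.
rotations symmetries : Transfer → List Transfer
rotations t = map (λ σ → transport σ t) (id ∷ rotate ∷ rotate ∘ rotate ∷ rotate ∘ rotate ∘ rotate ∷ [])
symmetries t = rotations t ++ rotations (transport reflect t)

inside outside : List Cell → Monomial
inside = map (_, true)
outside = map (_, false)

I[_]≐_ : Cell → Cell → Monomial
I[ u ]≐ x = inside [ x ] ++ outside (closed u ∖ [ x ])

o east north west south : Cell
o = 8 , 8
east = 9 , 8
north = 8 , 9
west = 7 , 8
south = 8 , 7

leaf : Monomial
leaf = inside (o ∷ east ∷ []) ++ outside (north ∷ west ∷ south ∷ [])

-- The centre is the only element of its I and each neighbour has |I| = 2, so the charge is 14 (1 -
-- 2 + 1) + 14 (1 - 1) - 4 = -4, one unit for each diagonal. Domination of a diagonal vertex forces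
-- a codeword that forms an edge with one of the four at distance 2.
poor : Cell → Monomial
poor (i , j) =
  inside ((i , j) ∷ (2 + i , j) ∷ (i ∸ 2 , j) ∷ (i , 2 + j) ∷ (i , j ∸ 2) ∷ []) ++
  outside ((suc i , j) ∷ (pred i , j) ∷ (i , suc j) ∷ (i , pred j) ∷
           (suc i , suc j) ∷ (suc i , pred j) ∷ (pred i , suc j) ∷ (pred i , pred j) ∷ [])

-- The edge (10,8)-(10,9) serves the diagonal (9,9) of the poor codeword o. It is paid for by (10,8),
-- unless (10,8) has no other codeword next to it.
served deferred : Monomial
served = poor o ++ inside [ 10 , 9 ]
deferred = served ++ outside ((10 , 7) ∷ (11 , 8) ∷ [])

-- The path (10,8)-(10,9)-(10,10) can spare 2, but is asked for 2 by the poor codeword (12,9) alone.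
-- A path (8,6)-(9,6)-(10,6) is then next in the pinwheel around o and pays instead.
overloaded : Monomial
overloaded = deferred ++ poor (12 , 9) ++ inside ((10 , 10) ∷ (9 , 6) ∷ (10 , 6) ∷ []) ++ outside [ 11 , 7 ]

-- The next path is overloaded as well; a codeword of the edge (12,6)-(12,7), wedged between the
-- two paths, pays instead.
overloaded² : Monomial
overloaded² = overloaded ++ poor (9 , 4) ++ inside ((6 , 7) ∷ (6 , 6) ∷ (12 , 6) ∷ []) ++
  outside ((7 , 6) ∷ (8 , 5) ∷ (7 , 5) ∷ [])

-- The transfer of 14 makes up both terms of the charge with singletons I; for u = v they cancel.
identifyingTransfers : List Transfer
identifyingTransfers =
  concatMap rotations
    ( transfer 14 o east (I[ east ]≐ o)
    ∷ transfer 4 east o (leaf ++ I[ west ]≐ o)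
    ∷ transfer 4 o east (outside [ o ] ++ inside (neighbours o))
    ∷ transfer 4 o east (outside (o ∷ west ∷ []) ++ inside (east ∷ north ∷ south ∷ []))
    ∷ []) ++
  concatMap symmetries
    ( transfer 4 east o (leaf ++ I[ north ]≐ o)
    ∷ transfer 4 o east (outside (o ∷ north ∷ []) ++ inside (east ∷ west ∷ south ∷ []))
    ∷ transfer 1 (10 , 8) o served
    ∷ transfer 1 (10 , 9) (10 , 8) deferred
    ∷ transfer 1 (9 , 6) (10 , 9) overloaded
    ∷ transfer 1 (12 , 6) (9 , 6) overloaded²
    ∷ transfer 1 (12 , 7) (12 , 6) (overloaded² ++ inside [ 13 , 7 ])
    ∷ [])

-- Here I(`o`) = I(`east`) = {`o`}, and no other noncodeword has this I, so the charge of `o` is 6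
-- (1 - 2 + 1) + 6 (2 - 2) - 2 = -2.
needy : Monomial
needy = outside (north ∷ west ∷ south ∷ []) ++ I[ east ]≐ o

locatingTransfers : List Transfer
locatingTransfers =
  concatMap rotations
    ( transfer 6 o east (I[ east ]≐ o)
    ∷ transfer 2 o east (outside [ o ] ++ inside (neighbours o))
    ∷ transfer 2 o east (outside (o ∷ west ∷ []) ++ inside (east ∷ north ∷ south ∷ []))
    ∷ []) ++
  concatMap symmetries
    ( transfer 2 o east (outside (o ∷ north ∷ []) ++ inside (east ∷ west ∷ south ∷ []))
    ∷ transfer 1 (6 , 8) o (needy ++ inside ((6 , 8) ∷ (6 , 9) ∷ []))
    ∷ transfer 1 (8 , 10) o (needy ++ inside ((8 , 10) ∷ (7 , 10) ∷ []))
    ∷ [])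

-- Apart from the singleton terms, the charge of v gets 14 from each codeword next to v, 14 + 14 - 4
-- = 24 from v itself, and the constant -28.
identifying-balanced : balanced identifyingClauses 14 24 28 identifyingTransfers ≡ true
identifying-balanced = refl

-- Likewise 6 from each neighbouring codeword, 6 + 12 - 2 = 16 from v itself, and the constant -12.
locating-balanced : balanced locatingClauses 6 16 12 locatingTransfers ≡ true
locating-balanced = refl

-- Sums over a period

∑ : ℕ → (ℕ → ℕ) → ℕ
∑ zero f = 0
∑ (suc n) f = f 0 + ∑ n (f ∘ suc)

∑-cong : ∀ n {f g} → (∀ k → f k ≡ g k) → ∑ n f ≡ ∑ n g
∑-cong zero eq = refl
∑-cong (suc n) eq = cong₂ _+_ (eq 0) (∑-cong n (eq ∘ suc))

∑-mono : ∀ n {f g} → (∀ k → f k ≤ g k) → ∑ n f ≤ ∑ n g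
∑-mono zero le = z≤n
∑-mono (suc n) le = +-mono-≤ (le 0) (∑-mono n (le ∘ suc))

∑-zero : ∀ n → ∑ n (λ _ → 0) ≡ 0
∑-zero zero = refl
∑-zero (suc n) = ∑-zero n

∑-one : ∀ n → ∑ n (λ _ → 1) ≡ n
∑-one zero = refl
∑-one (suc n) = cong suc (∑-one n)

∑-linear : ∀ n a f g → ∑ n (λ k → a * f k + g k) ≡ a * ∑ n f + ∑ n g
∑-linear zero a f g = sym (trans (+-identityʳ (a * 0)) (*-zeroʳ a))
∑-linear (suc n) a f g = trans (cong (a * f 0 + g 0 +_) (∑-linear n a (f ∘ suc) (g ∘ suc)))
  (regroup a (f 0) (g 0) (∑ n (f ∘ suc)) (∑ n (g ∘ suc)))
  where
  regroup : ∀ a x y u v → a * x + y + (a * u + v) ≡ a * (x + u) + (y + v)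
  regroup = solve-∀

∑-++ : ∀ m n f → ∑ (m + n) f ≡ ∑ m f + ∑ n (f ∘ (m +_))
∑-++ zero n f = refl
∑-++ (suc m) n f = trans (cong (f 0 +_) (∑-++ m n (f ∘ suc))) (sym (+-assoc (f 0) _ _))

-- Passing from `s` to `suc s` drops `f s` and appends `f (n + s)`, which is equal to it.
∑-rotate : ∀ n f → (∀ k → f (n + k) ≡ f k) → ∀ s → ∑ n (f ∘ (s +_)) ≡ ∑ n f
∑-rotate n f per zero = refl
∑-rotate n f per (suc s) = trans (+-cancelˡ-≡ (f s) _ _ step) (∑-rotate n f per s)
  where
  open ≡-Reasoning
  step : f s + ∑ n (λ k → f (suc s + k)) ≡ f s + ∑ n (λ k → f (s + k))
  step = begin
    f s + ∑ n (λ k → f (suc s + k))      ≡⟨ cong₂ _+_ (cong f (sym (+-identityʳ s))) (∑-cong n λ k → cong f (sym (+-suc s k))) ⟩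
    ∑ (1 + n) (λ k → f (s + k))          ≡⟨ cong (λ m → ∑ m (λ k → f (s + k))) (+-comm 1 n) ⟩
    ∑ (n + 1) (λ k → f (s + k))          ≡⟨ ∑-++ n 1 (λ k → f (s + k)) ⟩
    ∑ n (λ k → f (s + k)) + (f (s + (n + 0)) + 0) ≡⟨ cong (∑ n (λ k → f (s + k)) +_) (trans (+-identityʳ _) (trans (cong f (lemma s n)) (per s))) ⟩
    ∑ n (λ k → f (s + k)) + f s          ≡⟨ +-comm _ (f s) ⟩
    f s + ∑ n (λ k → f (s + k))          ∎
    where
    lemma : ∀ s n → s + (n + 0) ≡ n + s
    lemma = solve-∀

∑-periods : ∀ q p f → (∀ k → f (p + k) ≡ f k) → ∑ (q * p) f ≡ q * ∑ p f
∑-periods zero p f per = refl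
∑-periods (suc q) p f per = trans (∑-++ p (q * p) f)
  (cong (∑ p f +_) (trans (∑-cong (q * p) per) (∑-periods q p f per)))

𝟙 : Bool → ℕ
𝟙 b = if b then 1 else 0

-- Double counting over a period

position : ℕ → Cell → ℕ
position d (i , j) = i + j * d

module Discharging (n d : ℕ) (χ : ℕ → Bool) (periodic : ∀ k → χ (n + k) ≡ χ k) where

  config : ℕ → Config
  config k x = χ (k + position d x)

  position-⊕ : ∀ z x k → k + position d (z ⊕ x) ≡ position d z + k + position d x
  position-⊕ (a , b) (i , j) k = lemma a b i j k d
    where
    lemma : ∀ a b i j k d → k + (a + i + (b + j) * d) ≡ a + b * d + k + (i + j * d)
    lemma = solve-∀

  config-⊕ : ∀ z x k → config k (z ⊕ x) ≡ config (position d z + k) x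
  config-⊕ z x k = cong χ (position-⊕ z x k)

  valid : ∀ ss → (∀ k → All (Satisfies (config k)) ss) → ∀ k → Valid ss (config k)
  valid ss sat k z = All.map (Any.map (λ {x} → subst T (sym (config-⊕ z x k)))) (sat (position d z + k))

  value-shift : ∀ z m k → value (config k) (shift z m) ≡ value (config (position d z + k)) m
  value-shift z [] k = refl
  value-shift z ((x , b) ∷ m) k rewrite config-⊕ z x k | value-shift z m k = refl

  config-periodic : ∀ k x → config (n + k) x ≡ config k x
  config-periodic k x = trans (cong χ (+-assoc n k _)) (periodic _)

  value-periodic : ∀ m k → value (config (n + k)) m ≡ value (config k) m
  value-periodic [] k = refl
  value-periodic ((x , b) ∷ m) k rewrite config-periodic k x | value-periodic m k = refl

  frequency : Monomial → ℕ
  frequency m = ∑ n λ k → value (config k) m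

  mass : Polynomial → ℕ
  mass p = ∑ n λ k → total (config k) p

  mass-∷ : ∀ a m p → mass ((a , m) ∷ p) ≡ a * frequency m + mass p
  mass-∷ a m p = ∑-linear n a _ _

  -- Shifting by `z` moves the base point `k` by `position d z`, which a sum over a full period does
  -- not notice.
  frequency-shift : ∀ z m → frequency (shift z m) ≡ frequency m
  frequency-shift z m = trans (∑-cong n (value-shift z m))
    (∑-rotate n (λ k → value (config k) m) (value-periodic m) (position d z))

  frequency-cell : ∀ x → frequency [ x , true ] ≡ ∑ n (𝟙 ∘ χ)
  frequency-cell x = trans (∑-cong n λ k → trans (single (config k x)) (cong (𝟙 ∘ χ) (+-comm k (position d x))))
    (∑-rotate n (𝟙 ∘ χ) (cong 𝟙 ∘ periodic) (position d x))
    where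
    single : ∀ b → (if b xor true then 0 else 1) ≡ 𝟙 b
    single true = refl
    single false = refl

  mass-++ : ∀ p q → mass (p ++ q) ≡ mass p + mass q
  mass-++ [] q = cong (_+ mass q) (sym (∑-zero n))
  mass-++ ((a , m) ∷ p) q = trans (mass-∷ a m (p ++ q))
    (trans (cong (a * frequency m +_) (mass-++ p q))
    (trans (sym (+-assoc (a * frequency m) _ _)) (cong (_+ mass q) (sym (mass-∷ a m p)))))

  -- Conservation of charge: gain and loss are two shifts of the same condition.
  gain≡loss : ∀ ts → mass (map gain ts) ≡ mass (map loss ts)
  gain≡loss [] = refl
  gain≡loss (transfer a g r m ∷ ts) = trans (mass-∷ a (shift ((16 , 16) ⊖ r) m) (map gain ts)) (trans
    (cong₂ (λ x y → a * x + y) (trans (frequency-shift ((16 , 16) ⊖ r) m) (sym (frequency-shift ((16 , 16) ⊖ g) m))) (gain≡loss ts))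
    (sym (mass-∷ a (shift ((16 , 16) ⊖ g) m) (map loss ts))))

  mass-cells : ∀ a xs → mass (cells a xs) ≡ length xs * a * ∑ n (𝟙 ∘ χ)
  mass-cells a [] = ∑-zero n
  mass-cells a (x ∷ xs) = trans (mass-∷ a [ x , true ] (cells a xs))
    (trans (cong₂ (λ u v → a * u + v) (frequency-cell x) (mass-cells a xs))
           (lemma a (length xs) (∑ n (𝟙 ∘ χ))))
    where
    lemma : ∀ a l s → a * s + l * a * s ≡ (a + l * a) * s
    lemma = solve-∀

  mass-base : ∀ a b → mass (base a b) ≡ (4 * a + b) * ∑ n (𝟙 ∘ χ)
  mass-base a b = trans (mass-++ (cells a (neighbours (16 , 16))) (cells b [ 16 , 16 ]))
    (trans (cong₂ _+_ (mass-cells a (neighbours (16 , 16))) (mass-cells b [ 16 , 16 ]))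
           (lemma a b (∑ n (𝟙 ∘ χ))))
    where
    lemma : ∀ a b s → 4 * a * s + 1 * b * s ≡ (4 * a + b) * s
    lemma = solve-∀

  -- The local inequality is summed over all `k`. The transfers cancel, and each codeword is counted
  -- with weight `a` from four neighbours and `b` from itself.
  discharge : ∀ ss → (∀ k → All (Satisfies (config k)) ss) → ∀ a b e ts →
    balanced ss a b e ts ≡ true → e * n ≤ (4 * a + b) * ∑ n (𝟙 ∘ χ)
  discharge ss sat a b e ts found = +-cancelʳ-≤ (mass (map loss ts)) _ _ (begin
    e * n + mass (map loss ts)                        ≡⟨ cong (λ x → e * x + mass (map loss ts)) (∑-one n) ⟨
    e * frequency [] + mass (map loss ts)             ≡⟨ mass-∷ e [] (map loss ts) ⟨
    mass ((e , []) ∷ map loss ts)                     ≤⟨ ∑-mono n (λ k → search-sound 100 ss [] ((e , []) ∷ map loss ts) (base a b ++ map gain ts) (Equivalence.from T-≡ found) (config k) (valid ss sat k) []) ⟩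
    mass (base a b ++ map gain ts)                    ≡⟨ mass-++ (base a b) (map gain ts) ⟩
    mass (base a b) + mass (map gain ts)           ≡⟨ cong₂ _+_ (mass-base a b) (gain≡loss ts) ⟩
    (4 * a + b) * ∑ n (𝟙 ∘ χ) + mass (map loss ts)    ∎)
    where open ≤-Reasoning

-- Codes in circulant graphs as configurations

module _ (n : ℕ) .{{_ : NonZero n}} where

  infix 4 _≈_
  _≈_ : ℕ → ℕ → Set
  a ≈ b = a % n ≡ b % n

  ≈-+ʳ : ∀ {a b} c → a ≈ b → a + c ≈ b + c
  ≈-+ʳ {a} {b} c eq = trans (%-distribˡ-+ a c n)
    (trans (cong (λ x → (x + c % n) % n) eq) (sym (%-distribˡ-+ b c n)))

  ≈-+ˡ : ∀ {a b} c → a ≈ b → c + a ≈ c + b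
  ≈-+ˡ {a} {b} c eq = subst₂ _≈_ (+-comm a c) (+-comm b c) (≈-+ʳ c eq)

  %-≈ : ∀ a → a % n ≈ a
  %-≈ a = m%n%n≡m%n a n

  ≈-+ʳ⁻ : ∀ {a b} c → a + c ≈ b + c → a ≈ b
  -- Adding `c * pred n` undoes the addition of `c`, since together they make `c * n`.
  ≈-+ʳ⁻ {a} {b} c eq = trans (sym (cancel a)) (trans (≈-+ʳ (c * pred n) eq) (cancel b))
    where
    cancel : ∀ x → x + c + c * pred n ≈ x
    cancel x = trans (cong (_% n) (trans (+-assoc x c _)
      (cong (x +_) (trans (sym (*-suc c (pred n))) (cong (c *_) (suc-pred n)))))) ([m+kn]%n≡m%n x c n)

  ≈-+ˡ⁻ : ∀ {a b} c → c + a ≈ c + b → a ≈ b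
  ≈-+ˡ⁻ {a} {b} c eq = ≈-+ʳ⁻ c (subst₂ _≈_ (+-comm c a) (+-comm c b) eq)

  ≉-+ : ∀ a {δ} → 0 < δ → δ < n → ¬ (a ≈ a + δ)
  ≉-+ a {δ} 0<δ δ<n eq = <⇒≢ 0<δ (trans (sym (m<n⇒m%n≡m (<-trans 0<δ δ<n))) (trans
    (≈-+ˡ⁻ {0} {δ} a (trans (cong (_% n) (+-identityʳ a)) eq)) (m<n⇒m%n≡m δ<n)))

  toℕ-% : ∀ (u : Fin n) → toℕ u % n ≡ toℕ u
  toℕ-% u = m<n⇒m%n≡m (toℕ<n u)

  toℕ-mod : ∀ a → toℕ (a mod n) ≡ a % n
  toℕ-mod a = toℕ-fromℕ< (m%n<n a n)

  complement-step : ∀ (u w : Fin n) {δ} → δ ≤ n → toℕ u ≡ (toℕ w + δ) % n → toℕ w ≡ (toℕ u + (n ∸ δ)) % n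
  complement-step u w {δ} δ≤n eq = sym (begin
    (toℕ u + (n ∸ δ)) % n               ≡⟨ cong (λ x → (x + (n ∸ δ)) % n) eq ⟩
    ((toℕ w + δ) % n + (n ∸ δ)) % n     ≡⟨ ≈-+ʳ (n ∸ δ) (%-≈ (toℕ w + δ)) ⟩
    (toℕ w + δ + (n ∸ δ)) % n           ≡⟨ cong (_% n) (trans (+-assoc (toℕ w) δ _) (cong (toℕ w +_) (m+[n∸m]≡n δ≤n))) ⟩
    (toℕ w + n) % n                     ≡⟨ [m+n]%n≡m%n (toℕ w) n ⟩
    toℕ w % n                           ≡⟨ toℕ-% w ⟩
    toℕ w                               ∎)
    where open ≡-Reasoning

-- Steps backwards are written as additions of `n ∸ 1` and `n ∸ d`, so that every neighbour is a sum
-- modulo `n`.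
step : ℕ → ℕ → Fin 5 → ℕ
step n d 0F = 0
step n d 1F = 1
step n d 2F = n ∸ 1
step n d 3F = d
step n d 4F = n ∸ d

module Circulant (n d : ℕ) {{_ : NonZero n}} (2≤d : 2 ≤ d) (2d<n : 2 * d < n) where

  0<d : 0 < d
  0<d = <-trans z<s 2≤d

  d<n : d < n
  d<n = ≤-<-trans (m≤m+n d _) 2d<n

  1<n : 1 < n
  1<n = <-trans 2≤d d<n

  nbr⇒step : ∀ {u w} → CircN n d w u → ∃ λ i → toℕ w ≡ (toℕ u + step n d i) % n
  nbr⇒step {u} (inj₁ refl) = 0F , sym (trans (cong (_% n) (+-identityʳ (toℕ u))) (toℕ-% n u))
  nbr⇒step (inj₂ (_ , inj₁ (inj₁ eq))) = 1F , eq
  nbr⇒step {u} {w} (inj₂ (_ , inj₁ (inj₂ eq))) = 2F , complement-step n u w (<⇒≤ 1<n) eq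
  nbr⇒step (inj₂ (_ , inj₂ (inj₁ eq))) = 3F , eq
  nbr⇒step {u} {w} (inj₂ (_ , inj₂ (inj₂ eq))) = 4F , complement-step n u w (<⇒≤ d<n) eq

  shifted-≢ : ∀ {u w : Fin n} {δ} → 0 < δ → δ < n → toℕ w ≡ (toℕ u + δ) % n → u ≢ w
  shifted-≢ {u} 0<δ δ<n eq refl = ≉-+ n (toℕ u) 0<δ δ<n (trans (toℕ-% n u) eq)

  complement-step⁻ : ∀ {u w : Fin n} {δ} → δ ≤ n → toℕ w ≡ (toℕ u + (n ∸ δ)) % n → toℕ u ≡ (toℕ w + δ) % n
  complement-step⁻ {u} {w} {δ} δ≤n eq = subst (λ x → toℕ u ≡ (toℕ w + x) % n) (m∸[m∸n]≡n δ≤n)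
    (complement-step n w u (m∸n≤m n δ) eq)

  step⇒nbr : ∀ {u w} i → toℕ w ≡ (toℕ u + step n d i) % n → CircN n d w u
  step⇒nbr {u} 0F eq = inj₁ (toℕ-injective (trans eq (trans (cong (_% n) (+-identityʳ (toℕ u))) (toℕ-% n u))))
  step⇒nbr 1F eq = inj₂ (shifted-≢ z<s 1<n eq , inj₁ (inj₁ eq))
  step⇒nbr 2F eq = inj₂ (shifted-≢ (m<n⇒0<n∸m 1<n) (∸-monoʳ-< z<s (<⇒≤ 1<n)) eq , inj₁ (inj₂ (complement-step⁻ (<⇒≤ 1<n) eq)))
  step⇒nbr 3F eq = inj₂ (shifted-≢ 0<d d<n eq , inj₂ (inj₁ eq))
  step⇒nbr 4F eq = inj₂ (shifted-≢ (m<n⇒0<n∸m d<n) (∸-monoʳ-< 0<d (<⇒≤ d<n)) eq , inj₂ (inj₂ (complement-step⁻ (<⇒≤ d<n) eq)))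

  module _ (C : Subset n) where

    χ : ℕ → Bool
    χ a = Vec.lookup C (a mod n)

    χ-≈ : ∀ {a b} → a % n ≡ b % n → χ a ≡ χ b
    χ-≈ {a} {b} eq = cong (Vec.lookup C) (toℕ-injective (trans (toℕ-mod n a) (trans eq (sym (toℕ-mod n b)))))

    χ-periodic : ∀ k → χ (n + k) ≡ χ k
    χ-periodic k = χ-≈ (trans (cong (_% n) (+-comm n k)) ([m+n]%n≡m%n k n))

    open Discharging n d χ χ-periodic public

    ∈⇒χ : ∀ {w a} → toℕ w ≡ a % n → w ∈ˢ C → T (χ a)
    ∈⇒χ {w} {a} eq w∈C = Equivalence.from T-≡
      (trans (cong (Vec.lookup C) (toℕ-injective (trans (toℕ-mod n a) (sym eq)))) ([]=⇒lookup w∈C))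

  Interior : Cell → Set
  Interior (suc _ , suc _) = ⊤
  Interior _ = ⊥

  position-neighbour : ∀ k x → Interior x → ∀ i →
    (k + position d (neighbour x i)) % n ≡ (k + position d x + step n d i) % n
  position-neighbour k (suc i , suc j) _ 0F = cong (_% n) (sym (+-identityʳ _))
  position-neighbour k (suc i , suc j) _ 1F = cong (_% n) (lemma k i j d)
    where
    lemma : ∀ k i j d → k + (2 + i + (1 + j) * d) ≡ k + (1 + i + (1 + j) * d) + 1
    lemma = solve-∀
  position-neighbour k (suc i , suc j) _ 2F = sym (trans (cong (_% n) (begin
    k + (suc i + (d + j * d)) + (n ∸ 1)   ≡⟨ lemma k i (d + j * d) (n ∸ 1) ⟩
    k + (i + (d + j * d)) + (1 + (n ∸ 1)) ≡⟨ cong (k + (i + (d + j * d)) +_) (m+[n∸m]≡n (<⇒≤ 1<n)) ⟩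
    k + (i + (d + j * d)) + n             ∎)) ([m+n]%n≡m%n _ n))
    where
    open ≡-Reasoning
    lemma : ∀ k i x m → k + (1 + i + x) + m ≡ k + (i + x) + (1 + m)
    lemma = solve-∀
  position-neighbour k (suc i , suc j) _ 3F = cong (_% n) (lemma k i j d)
    where
    lemma : ∀ k i j d → k + (1 + i + (2 + j) * d) ≡ k + (1 + i + (1 + j) * d) + d
    lemma = solve-∀
  position-neighbour k (suc i , suc j) _ 4F = sym (trans (cong (_% n) (begin
    k + (suc i + (d + j * d)) + (n ∸ d)   ≡⟨ lemma k i (j * d) (n ∸ d) d ⟩
    k + (suc i + j * d) + (d + (n ∸ d))   ≡⟨ cong (k + (suc i + j * d) +_) (m+[n∸m]≡n (<⇒≤ d<n)) ⟩
    k + (suc i + j * d) + n               ∎)) ([m+n]%n≡m%n _ n))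
    where
    open ≡-Reasoning
    lemma : ∀ k i x m d → k + (1 + i + (d + x)) + m ≡ k + (1 + i + x) + (d + m)
    lemma = solve-∀

  module _ (k : ℕ) (x : Cell) (x° : Interior x) where
    private
      u = (k + position d x) mod n

    offset : ∀ i → (toℕ u + step n d i) % n ≡ (k + position d (neighbour x i)) % n
    offset i = trans (≈-+ʳ n (step n d i) (trans (cong (_% n) (toℕ-mod n (k + position d x))) (%-≈ n _)))
      (sym (position-neighbour k x x° i))

    nbr⇒cell : ∀ {w} → CircN n d w u → ∃ λ y → y ∈ closed x × toℕ w ≡ (k + position d y) % n
    nbr⇒cell nb with nbr⇒step nb
    ... | i , eq = neighbour x i , ∈-tabulate⁺ {f = neighbour x} i , trans eq (offset i)

    cell⇒nbr : ∀ {w y} → y ∈ closed x → toℕ w ≡ (k + position d y) % n → CircN n d w u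
    cell⇒nbr y∈ eq with ∈-tabulate⁻ {f = neighbour x} y∈
    ... | i , refl = step⇒nbr i (trans eq (sym (offset i)))

  mod-≢ : ∀ a {δ} → 0 < δ → δ < n → a mod n ≢ (a + δ) mod n
  mod-≢ a {δ} 0<δ δ<n eq = ≉-+ n a 0<δ δ<n
    (trans (sym (toℕ-mod n a)) (trans (cong toℕ eq) (toℕ-mod n (a + δ))))

  record Separable (uv : Cell × Cell) : Set where
    constructor separable
    field
      gap : ℕ
      gap-position : position d (proj₂ uv) ≡ position d (proj₁ uv) + gap
      0<gap : 0 < gap
      gap<n : gap < n
      {{u°}} : Interior (proj₁ uv)
      {{v°}} : Interior (proj₂ uv)

  module _ (C : Subset n) (k : ℕ) where

    dominated : Dominating (CircN n d) C → Satisfies (config C k) (closed (1 , 1))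
    dominated dom with dom ((k + position d (1 , 1)) mod n)
    ... | w , w∈C , nb with nbr⇒cell k (1 , 1) tt nb
    ... | y , y∈ , eq = lose y∈ (∈⇒χ C {a = k + position d y} eq w∈C)

    -- The codeword occupies a cell of `closed u`; outside `closed v` that cell would satisfy the
    -- clause.
    nbr-via-separator : ∀ u v → Interior u → Interior v → ¬ Satisfies (config C k) (closed u ∖ closed v) →
      ∀ {w} → w ∈ˢ C → CircN n d w ((k + position d u) mod n) → CircN n d w ((k + position d v) mod n)
    nbr-via-separator u v u° v° unsat w∈C nb with nbr⇒cell k u u° nb
    ... | y , y∈ , eq with T? (member y (closed v))
    ...   | yes m with find (Any.any⁻ (y ==_) (closed v) m)
    ...     | z , z∈ , y==z rewrite ==⇒≡ y z y==z = cell⇒nbr k v v° z∈ eq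
    nbr-via-separator u v u° v° unsat w∈C nb | y , y∈ , eq | no ¬m =
      ⊥-elim (unsat (lose (∈-filter⁺ (λ x → ¬? (T? (member x (closed v)))) y∈ ¬m) (∈⇒χ C {a = k + position d y} eq w∈C)))

    separated : ∀ {u v} → Separable (u , v) →
      ((k + position d u) mod n ≢ (k + position d v) mod n →
        ¬ SameI (CircN n d) C ((k + position d u) mod n) ((k + position d v) mod n)) →
      Satisfies (config C k) (separator (u , v))
    separated {u} {v} sep ¬same with Any.any? (λ x → T? (config C k x)) (separator (u , v))
    ... | yes sat = sat
    ... | no unsat = ⊥-elim (¬same
        (subst (λ p → (k + position d u) mod n ≢ p mod n)
          (trans (+-assoc k (position d u) gap) (cong (k +_) (sym gap-position)))
          (mod-≢ (k + position d u) 0<gap gap<n))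
        (λ w w∈C → mk⇔ (nbr-via-separator u v u° v° (unsat ∘ Any.++⁺ˡ) w∈C) (nbr-via-separator v u v° u° (unsat ∘ Any.++⁺ʳ (closed u ∖ closed v)) w∈C)))
      where open Separable sep

  -- The hypotheses on `d` keep the differences 1, d, 2, 2d, d + 1 and d - 1 strictly between 0 and
  -- n: the last is positive by `2≤d`, and 2d is below n by `2d<n`.
  closePairs-separable : All Separable closePairs
  closePairs-separable =
      separable 1 (lemma₁ d) z<s 1<n
    ∷ separable d (lemma₂ d) 0<d d<n
    ∷ separable 2 (lemma₃ d) z<s (≤-<-trans (≤-trans 2≤d (m≤m+n d _)) 2d<n)
    ∷ separable (2 * d) (lemma₄ d) (≤-trans 0<d (m≤m+n d _)) 2d<n
    ∷ separable (1 + d) (lemma₅ d) z<s (≤-<-trans (+-mono-≤ 0<d (m≤m+n d 0)) 2d<n)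
    ∷ separable (d ∸ 1) (subst (λ x → 1 + 2 * x ≡ 2 + 1 * x + (d ∸ 1)) (m+[n∸m]≡n 0<d) (lemma₆ (d ∸ 1)))
        (m<n⇒0<n∸m 2≤d) (≤-<-trans (m∸n≤m d 1) d<n)
    ∷ []
    where
    lemma₁ : ∀ d → 2 + 1 * d ≡ 1 + 1 * d + 1
    lemma₁ = solve-∀
    lemma₂ : ∀ d → 1 + 2 * d ≡ 1 + 1 * d + d
    lemma₂ = solve-∀
    lemma₃ : ∀ d → 3 + 1 * d ≡ 1 + 1 * d + 2
    lemma₃ = solve-∀
    lemma₄ : ∀ d → 1 + 3 * d ≡ 1 + 1 * d + 2 * d
    lemma₄ = solve-∀
    lemma₅ : ∀ d → 2 + 2 * d ≡ 1 + 1 * d + (1 + d)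
    lemma₅ = solve-∀
    lemma₆ : ∀ e → 1 + 2 * (1 + e) ≡ 2 + 1 * (1 + e) + e
    lemma₆ = solve-∀

  identifying⇒clauses : ∀ C → Identifying (CircN n d) C → ∀ k → All (Satisfies (config C k)) identifyingClauses
  identifying⇒clauses C (_ , dom , id) k = dominated C k dom ∷
    All.map⁺ (All.map (λ sep → separated C k sep (id _ _)) closePairs-separable)

  locating⇒clauses : ∀ C → LocatingDominating (CircN n d) C → ∀ k → All (Satisfies (config C k)) locatingClauses
  locating⇒clauses C (_ , dom , loc) k = dominated C k dom ∷ All.map⁺ (All.map separated′ closePairs-separable)
    where
    separated′ : ∀ {uv} → Separable uv → Satisfies (config C k) (proj₁ uv ∷ proj₂ uv ∷ separator uv)
    separated′ {u , v} sep with T? (config C k u) | T? (config C k v)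
    ... | yes u∈C | _ = here u∈C
    ... | no _ | yes v∈C = there (here v∈C)
    ... | no u∉C | no v∉C = there (there (separated C k sep
            (loc _ _ (u∉C ∘ ∈⇒χ C (toℕ-mod n _)) (v∉C ∘ ∈⇒χ C (toℕ-mod n _)))))

count-∑ : ∀ {n} (C : Subset n) (g : ℕ → Bool) → (∀ i → Vec.lookup C i ≡ g (toℕ i)) → ∣ C ∣ ≡ ∑ n (𝟙 ∘ g)
count-∑ Vec.[] g eq = refl
count-∑ (b Vec.∷ C) g eq with eq Fin.zero
count-∑ (true Vec.∷ C) g eq | e rewrite sym e = cong suc (count-∑ C (g ∘ suc) (eq ∘ Fin.suc))
count-∑ (false Vec.∷ C) g eq | e rewrite sym e = count-∑ C (g ∘ suc) (eq ∘ Fin.suc)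

-- Periodic codes

module PeriodicCode (p e : ℕ) {{_ : NonZero p}} (s : ℕ → Bool) where

  weight : ℕ
  weight = ∑ p (λ k → 𝟙 (s (k % p)))

  move : Fin p → Fin 5 → ℕ
  move r i = (toℕ r + step p e i) % p

  Distinguishes : Fin p → Fin p → Set
  Distinguishes r r′ = ∃ λ i → T (s (move r i)) × (∀ j → move r i ≢ move r′ j)

  -- `Separating` makes the five steps distinct modulo `p`, so that reduction modulo `p` is
  -- injective on closed neighbourhoods.
  Covering Separating : Set
  Covering = ∀ r → ∃ λ i → T (s (move r i))
  Separating = ∀ i j → step p e i % p ≡ step p e j % p → i ≡ j

  -- `free` selects the residues to be told apart: all of them for identifying codes, the
  -- noncodewords for locating-dominating ones.
  Resolving : (ℕ → Bool) → Set
  Resolving free = ∀ r r′ → T (free (toℕ r)) → T (free (toℕ r′)) →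
    r ≡ r′ ⊎ Distinguishes r r′ ⊎ Distinguishes r′ r

  covering? : Dec Covering
  covering? = all? λ r → any? λ i → T? _

  separating? : Dec Separating
  separating? = all? λ i → all? λ j → (_ ≟ _) →-dec (i ≟ᶠ j)

  distinguishes? : ∀ r r′ → Dec (Distinguishes r r′)
  distinguishes? r r′ = any? λ i → T? _ ×-dec all? λ j → ¬? (_ ≟ _)

  resolving? : ∀ free → Dec (Resolving free)
  resolving? free = all? λ r → all? λ r′ → T? _ →-dec (T? _ →-dec
    ((r ≟ᶠ r′) ⊎-dec (distinguishes? r r′ ⊎-dec distinguishes? r′ r)))

  -- Lifting a periodic code to the circulant graph

  module Lift (n d : ℕ) {{_ : NonZero n}} (2≤d : 2 ≤ d) (2d<n : 2 * d < n)
    (p∣n : p ∣ n) (e≤p : e ≤ p) (d≈e : d % p ≡ e % p) where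

    open Circulant n d 2≤d 2d<n

    %n%p : ∀ a → a % n % p ≡ a % p
    %n%p a = m∣n⇒o%n%m≡o%m p n a p∣n

    n∸-≈ : ∀ {a b} → a ≤ n → b ≤ p → a % p ≡ b % p → (n ∸ a) % p ≡ (p ∸ b) % p
    n∸-≈ {a} {b} a≤n b≤p a≈b = ≈-+ʳ⁻ p a (begin
      (n ∸ a + a) % p   ≡⟨ cong (_% p) (m∸n+n≡m a≤n) ⟩
      n % p             ≡⟨ n∣m⇒m%n≡0 n p p∣n ⟩
      0                 ≡⟨ n%n≡0 p ⟨
      p % p             ≡⟨ cong (_% p) (m∸n+n≡m b≤p) ⟨
      (p ∸ b + b) % p   ≡⟨ ≈-+ˡ p (p ∸ b) a≈b ⟨
      (p ∸ b + a) % p   ∎)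
      where open ≡-Reasoning

    step-≈ : ∀ i → step n d i % p ≡ step p e i % p
    step-≈ 0F = refl
    step-≈ 1F = refl
    step-≈ 2F = n∸-≈ (<⇒≤ 1<n) (>-nonZero⁻¹ p) refl
    step-≈ 3F = d≈e
    step-≈ 4F = n∸-≈ (<⇒≤ d<n) e≤p d≈e

    residue : Fin n → Fin p
    residue u = toℕ u mod p

    move-residue : ∀ (u w : Fin n) i → toℕ w ≡ (toℕ u + step n d i) % n → toℕ w % p ≡ move (residue u) i
    move-residue u w i eq = begin
      toℕ w % p                                  ≡⟨ cong (_% p) eq ⟩
      (toℕ u + step n d i) % n % p               ≡⟨ %n%p _ ⟩
      (toℕ u + step n d i) % p                   ≡⟨ ≈-+ˡ p (toℕ u) (step-≈ i) ⟩
      (toℕ u + step p e i) % p                   ≡⟨ ≈-+ʳ p (step p e i) (%-≈ p (toℕ u)) ⟨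
      (toℕ u % p + step p e i) % p               ≡⟨ cong (λ x → (x + step p e i) % p) (toℕ-mod p (toℕ u)) ⟨
      move (residue u) i                         ∎
      where open ≡-Reasoning

    C : Subset n
    C = Vec.tabulate (λ i → s (toℕ i % p))

    ∈C⇔ : ∀ {w} → w ∈ˢ C ⇔ T (s (toℕ w % p))
    ∈C⇔ {w} = mk⇔
      (λ w∈C → Equivalence.from T-≡ (trans (sym (lookup∘tabulate _ w)) ([]=⇒lookup w∈C)))
      (λ t → lookup⇒[]= w C (trans (lookup∘tabulate _ w) (Equivalence.to T-≡ t)))

    size : ∀ q → n ≡ q * p → ∣ C ∣ ≡ q * weight
    size q refl = trans (count-∑ C (λ k → s (k % p)) (lookup∘tabulate _))
      (∑-periods q p (λ k → 𝟙 (s (k % p))) (λ k → cong (𝟙 ∘ s) (trans (cong (_% p) (+-comm p k)) ([m+n]%n≡m%n k p))))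

    target : ∀ (u : Fin n) i → toℕ ((toℕ u + step n d i) mod n) ≡ (toℕ u + step n d i) % n
    target u i = toℕ-mod n _

    move∈C : ∀ (u : Fin n) i → T (s (move (residue u) i)) → (toℕ u + step n d i) mod n ∈ˢ C
    move∈C u i t = Equivalence.from ∈C⇔ (subst (T ∘ s) (sym (move-residue u _ i (target u i))) t)

    dominating : Covering → Dominating (CircN n d) C
    dominating cov u with cov (residue u)
    ... | i , t = _ , move∈C u i t , step⇒nbr i (target u i)

    distinguished : ∀ u v → Distinguishes (residue u) (residue v) →
      ∃ λ w → w ∈ˢ C × CircN n d w u × ¬ CircN n d w v
    distinguished u v (i , t , apart) = _ , move∈C u i t , step⇒nbr i (target u i) , far
      where
      far : ¬ CircN n d ((toℕ u + step n d i) mod n) v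
      far nb with nbr⇒step nb
      ... | j , eq = apart j (trans (sym (move-residue u _ i (target u i))) (move-residue v _ j eq))

    -- If u and v have equal residues, then a codeword adjacent to both is reached from both by the
    -- same step.
    resolved : Covering → Separating → ∀ free → Resolving free → ∀ u v →
      T (free (toℕ (residue u))) → T (free (toℕ (residue v))) → u ≢ v → ¬ SameI (CircN n d) C u v
    resolved cov sep free res u v fu fv u≢v same with res (residue u) (residue v) fu fv
    ... | inj₂ (inj₁ D) with distinguished u v D
    ...   | w , w∈C , near , far = far (Equivalence.to (same w w∈C) near)
    resolved cov sep free res u v fu fv u≢v same | inj₂ (inj₂ D) with distinguished v u D
    ...   | w , w∈C , near , far = far (Equivalence.from (same w w∈C) near)
    resolved cov sep free res u v fu fv u≢v same | inj₁ r≡r′ with dominating cov u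
    ... | w , w∈C , nu with nbr⇒step nu | nbr⇒step (Equivalence.to (same w w∈C) nu)
    ...   | i , eqᵢ | j , eqⱼ with sep i j (≈-+ˡ⁻ p (toℕ (residue u))
              (trans (sym (move-residue u w i eqᵢ)) (trans (move-residue v w j eqⱼ)
                (cong (λ r → (toℕ r + step p e j) % p) (sym r≡r′)))))
    ...     | refl = u≢v (toℕ-injective (trans (sym (toℕ-% n u))
                (trans (≈-+ʳ⁻ n (step n d i) (trans (sym eqᵢ) eqⱼ)) (toℕ-% n v))))

    nonempty : Covering → ∃ (_∈ˢ C)
    nonempty cov with dominating cov (0 mod n)
    ... | w , w∈C , _ = w , w∈C

    identifying : Covering → Separating → Resolving (λ _ → true) → Identifying (CircN n d) C
    identifying cov sep res = nonempty cov , dominating cov ,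
      λ u v → resolved cov sep (λ _ → true) res u v tt tt

    locatingDominating : Covering → Separating → Resolving (not ∘ s) → LocatingDominating (CircN n d) C
    locatingDominating cov sep res = nonempty cov , dominating cov ,
      λ u v u∉C v∉C → resolved cov sep (not ∘ s) res u v (unoccupied u u∉C) (unoccupied v v∉C)
      where
      unoccupied : ∀ u → ¬ (u ∈ˢ C) → T (not (s (toℕ (residue u))))
      unoccupied u u∉C with s (toℕ (residue u)) in eq
      ... | false = tt
      ... | true = u∉C (Equivalence.from ∈C⇔ (subst T (trans (sym eq) (cong s (toℕ-mod p (toℕ u)))) tt))

code : List ℕ → ℕ → Bool
code xs k = any (k ≡ᵇ_) xs

m≤n*o⇒m/n≤o : ∀ m n o .{{_ : NonZero n}} → m ≤ n * o → m / n ≤ o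
m≤n*o⇒m/n≤o m n o m≤n*o = ≤-trans (/-monoˡ-≤ n m≤n*o)
  (≤-reflexive (trans (cong (_/ n) (*-comm n o)) (m*n/n≡m o n)))

-- Lower bounds from discharging

module LowerBounds (n d : ℕ) {{_ : NonZero n}} (2≤d : 2 ≤ d) (2d<n : 2 * d < n) where
  open Circulant n d 2≤d 2d<n

  ∣C∣≡∑χ : ∀ C → ∣ C ∣ ≡ ∑ n (𝟙 ∘ χ C)
  ∣C∣≡∑χ C = count-∑ C (χ C) λ i →
    cong (Vec.lookup C) (toℕ-injective (sym (trans (toℕ-mod n _) (toℕ-% n i))))

  identifying-bound : ∀ C → Identifying (CircN n d) C → 7 * n / 20 ≤ ∣ C ∣
  identifying-bound C id = m≤n*o⇒m/n≤o (7 * n) 20 ∣ C ∣ (*-cancelˡ-≤ 4 (begin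
    4 * (7 * n)             ≡⟨ *-assoc 4 7 n ⟨
    28 * n                  ≤⟨ discharge C identifyingClauses (identifying⇒clauses C id) 14 24 28 identifyingTransfers identifying-balanced ⟩
    80 * ∑ n (𝟙 ∘ χ C)      ≡⟨ cong (80 *_) (∣C∣≡∑χ C) ⟨
    80 * ∣ C ∣              ≡⟨ *-assoc 4 20 ∣ C ∣ ⟩
    4 * (20 * ∣ C ∣)        ∎))
    where open ≤-Reasoning

  locating-bound : ∀ C → LocatingDominating (CircN n d) C → 3 * n / 10 ≤ ∣ C ∣
  locating-bound C ld = m≤n*o⇒m/n≤o (3 * n) 10 ∣ C ∣ (*-cancelˡ-≤ 4 (begin
    4 * (3 * n)             ≡⟨ *-assoc 4 3 n ⟨
    12 * n                  ≤⟨ discharge C locatingClauses (locating⇒clauses C ld) 6 16 12 locatingTransfers locating-balanced ⟩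
    40 * ∑ n (𝟙 ∘ χ C)      ≡⟨ cong (40 *_) (∣C∣≡∑χ C) ⟨
    40 * ∣ C ∣              ≡⟨ *-assoc 4 10 ∣ C ∣ ⟩
    4 * (10 * ∣ C ∣)        ∎))
    where open ≤-Reasoning

-- Lower bounds attained by lifted codes

module Optimality (p e : ℕ) {{_ : NonZero p}} (s : ℕ → Bool)
  (2≤e : 2 ≤ e) (e≤p : e ≤ p) (2*e≢0 : (2 * e) % p ≢ 0) where

  open PeriodicCode p e s

  module _ (n d : ℕ) {{_ : NonZero n}} (2d≤n : 2 * d ≤ n) (n≡0 : n % p ≡ 0) (d≡e : d % p ≡ e) where

    2≤d : 2 ≤ d
    2≤d = ≤-trans (subst (2 ≤_) (sym d≡e) 2≤e) (m%n≤m d p)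

    2*d%p≡2*e%p : (2 * d) % p ≡ (2 * e) % p
    2*d%p≡2*e%p = begin
      (2 * d) % p               ≡⟨ %-distribˡ-* 2 d p ⟩
      (2 % p * (d % p)) % p     ≡⟨ cong (λ x → (2 % p * x) % p) (m%n%n≡m%n d p) ⟨
      (2 % p * (d % p % p)) % p ≡⟨ %-distribˡ-* 2 (d % p) p ⟨
      (2 * (d % p)) % p         ≡⟨ cong (λ x → (2 * x) % p) d≡e ⟩
      (2 * e) % p               ∎
      where open ≡-Reasoning

    -- The boundary case n = 2d would force 2e ≡ 2d ≡ n ≡ 0 modulo `p`.
    2d<n : 2 * d < n
    2d<n = ≤∧≢⇒< 2d≤n λ 2d≡n → 2*e≢0 (trans (sym 2*d%p≡2*e%p) (trans (cong (_% p) 2d≡n) n≡0))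

    p∣n : p ∣ n
    p∣n = m%n≡0⇒n∣m n p n≡0

    open Lift n d 2≤d 2d<n p∣n e≤p (trans (sym (m%n%n≡m%n d p)) (cong (_% p) d≡e))
    open LowerBounds n d 2≤d 2d<n

    -- The equation says that the code has density a/b; as `p` divides `n`, the quotient is exact.
    size-ratio : ∀ a b → a * p ≡ weight * b → .{{_ : NonZero b}} → ∣ C ∣ ≡ a * n / b
    size-ratio a b eq with p∣n
    ... | divides q n≡q*p = begin
      ∣ C ∣                    ≡⟨ size q n≡q*p ⟩
      q * weight               ≡⟨ m*n/n≡m (q * weight) b ⟨
      q * weight * b / b       ≡⟨ cong (_/ b) (*-assoc q weight b) ⟩
      q * (weight * b) / b     ≡⟨ cong (λ x → q * x / b) eq ⟨
      q * (a * p) / b          ≡⟨ cong (_/ b) (lemma q a p) ⟩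
      a * (q * p) / b          ≡⟨ cong (λ x → a * x / b) n≡q*p ⟨
      a * n / b                ∎
      where
      open ≡-Reasoning
      lemma : ∀ q a p → q * (a * p) ≡ a * (q * p)
      lemma = solve-∀

    identifying-number : 7 * p ≡ weight * 20 → Covering → Separating → Resolving (λ _ → true) →
      (∃ λ (C : Subset n) → Identifying (CircN n d) C × ∣ C ∣ ≡ 7 * n / 20)
      × (∀ (C : Subset n) → Identifying (CircN n d) C → 7 * n / 20 ≤ ∣ C ∣)
    identifying-number w cov sep res = (C , identifying cov sep res , size-ratio 7 20 w) , identifying-bound

    locating-number : 3 * p ≡ weight * 10 → Covering → Separating → Resolving (not ∘ s) →
      (∃ λ (C : Subset n) → LocatingDominating (CircN n d) C × ∣ C ∣ ≡ 3 * n / 10)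
      × (∀ (C : Subset n) → LocatingDominating (CircN n d) C → 3 * n / 10 ≤ ∣ C ∣)
    locating-number w cov sep res = (C , locatingDominating cov sep res , size-ratio 3 10 w) , locating-bound

-- Periodic codes of densities 14/40, 7/20 and 6/20

code₄₀,₄ code₂₀,₆ code₂₀,₅ : ℕ → Bool
code₄₀,₄ = code (0 ∷ 2 ∷ 4 ∷ 10 ∷ 11 ∷ 12 ∷ 18 ∷ 19 ∷ 20 ∷ 26 ∷ 28 ∷ 30 ∷ 34 ∷ 36 ∷ [])
code₂₀,₆ = code (0 ∷ 1 ∷ 3 ∷ 4 ∷ 10 ∷ 12 ∷ 14 ∷ [])
code₂₀,₅ = code (0 ∷ 3 ∷ 6 ∷ 9 ∷ 13 ∷ 16 ∷ [])

module Code₄₀,₄ where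
  open PeriodicCode 40 4 code₄₀,₄

  covering : Covering
  covering = from-yes covering?

  separating : Separating
  separating = from-yes separating?

  resolving : Resolving (λ _ → true)
  resolving = from-yes (resolving? (λ _ → true))

  size≡ : 7 * 40 ≡ weight * 20
  size≡ = refl

module Code₂₀,₆ where
  open PeriodicCode 20 6 code₂₀,₆

  covering : Covering
  covering = from-yes covering?

  separating : Separating
  separating = from-yes separating?

  resolving : Resolving (λ _ → true)
  resolving = from-yes (resolving? (λ _ → true))

  size≡ : 7 * 20 ≡ weight * 20
  size≡ = refl

module Code₂₀,₅ where
  open PeriodicCode 20 5 code₂₀,₅

  covering : Covering
  covering = from-yes covering?

  separating : Separating
  separating = from-yes separating?

  resolving : Resolving (not ∘ code₂₀,₅)
  resolving = from-yes (resolving? (not ∘ code₂₀,₅))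

  size≡ : 3 * 20 ≡ weight * 10
  size≡ = refl

theorem4 : (n d : ℕ) → {{_ : NonZero n}} → 1 ≤ d → 2 * d ≤ n →
    ((n % 40 ≡ 0 → d % 40 ≡ 4 →
    (∃ λ (C : Subset n) → Identifying (CircN n d) C × ∣ C ∣ ≡ 7 * n / 20)
    × (∀ (C : Subset n) → Identifying (CircN n d) C → 7 * n / 20 ≤ ∣ C ∣))
    × (n % 20 ≡ 0 → d % 20 ≡ 6 →
    (∃ λ (C : Subset n) → Identifying (CircN n d) C × ∣ C ∣ ≡ 7 * n / 20)
    × (∀ (C : Subset n) → Identifying (CircN n d) C → 7 * n / 20 ≤ ∣ C ∣))
    × (n % 20 ≡ 0 → d % 20 ≡ 5 →
    (∃ λ (C : Subset n) → LocatingDominating (CircN n d) C × ∣ C ∣ ≡ 3 * n / 10)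
    × (∀ (C : Subset n) → LocatingDominating (CircN n d) C → 3 * n / 10 ≤ ∣ C ∣)))
theorem4 n d _ 2d≤n =
  (λ n≡0 d≡4 → Optimality.identifying-number 40 4 code₄₀,₄ 2≤2+ 4≤40 (λ ()) n d 2d≤n n≡0 d≡4
    Code₄₀,₄.size≡ Code₄₀,₄.covering Code₄₀,₄.separating Code₄₀,₄.resolving) ,
  (λ n≡0 d≡6 → Optimality.identifying-number 20 6 code₂₀,₆ 2≤2+ 6≤20 (λ ()) n d 2d≤n n≡0 d≡6
    Code₂₀,₆.size≡ Code₂₀,₆.covering Code₂₀,₆.separating Code₂₀,₆.resolving) ,
  (λ n≡0 d≡5 → Optimality.locating-number 20 5 code₂₀,₅ 2≤2+ 5≤20 (λ ()) n d 2d≤n n≡0 d≡5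
    Code₂₀,₅.size≡ Code₂₀,₅.covering Code₂₀,₅.separating Code₂₀,₅.resolving)
  where
  2≤2+ : ∀ {m} → 2 ≤ 2 + m
  2≤2+ = s≤s (s≤s z≤n)
  4≤40 : 4 ≤ 40
  4≤40 = from-yes (4 ≤? 40)
  5≤20 : 5 ≤ 20
  5≤20 = from-yes (5 ≤? 20)
  6≤20 : 6 ≤ 20
  6≤20 = from-yes (6 ≤? 20)
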